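{- For all $c>0$, and infinitely many integers $n$, there is a tournament $G$ with $n$ vertices, and a blockade $\mathcal{B}$ in $V(G)$ of length at least $1/c$, such that $G$ has no pure pair of order at least $cW(\mathcal{B})$, and there is no $\mathcal{B}$-rainbow copy in $G$ of either of $D_5, P_7^-$. Consequently $D_5$ and $P_7^-$ do not have the RSEH-property.
   Context: A tournament is a finite loopless digraph such that for every pair $u,v$ of distinct vertices exactly one of $uv,vu$ is an edge; an edge $uv$ is directed from $u$ to $v$. A pure pair in a tournament $G$ is an ordered pair $(A,B)$ of disjoint subsets of $V(G)$ such that $ab\in E(G)$ for all $a\in A,b\in B$; its order is $\min(|A|,|B|)$. A blockade in a set $V$ is a family $\mathcal{B}=(B_i:i\in I)$ of pairwise disjoint nonempty subsets (blocks) of $V$, where $I$ is a finite set of integers. Its length is $|I|$, and its width $W(\mathcal{B})$ is $\min_{i\in I}|B_i|$. A blockade in a tournament means a blockade in its vertex set. A copy in $G$ of a tournament $H$ is a subtournament of $G$ isomorphic to $H$; it is $\mathcal{B}$-rainbow if each of its vertices belongs to some block of $\mathcal{B}$ and no two of its vertices belong to the same block. A tournament $H$ has the rainbow strong EH-property (RSEH-property) if there exists $c$ with $0<c<1$ such that if $\mathcal{B}$ is a blockade of length at least $1/c$ in a tournament $G$, and there is no $\mathcal{B}$-rainbow copy of $H$ in $G$, then there is a pure pair in $G$ of order at least $cW(\mathcal{B})$. $D_5$ is the (unique up to isomorphism) tournament with five vertices in which every vertex has outdegree two. $P_7$ is the tournament with vertex set $\{1,\dots,7\}$ in which there is an edge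 from $i$ to $j$ if and only if $j-i$ is congruent to $1$, $2$ or $4$ modulo $7$; $P_7^-$ is obtained from $P_7$ by deleting one vertex (up to isomorphism it does not matter which). -}

module Defs where

open import Data.Bool.Base using (Bool; true; false; T; _xor_)
open import Data.Bool.Properties using (T?)
import Data.Bool.Properties as Bool
open import Data.Fin.Base using (Fin; toℕ; punchIn)
open import Data.Fin.Patterns using (6F)
open import Data.Fin.Properties using (_≟_; all?; punchIn-injective)
open import Data.Fin.Subset using (Subset; _∈_; _∉_; ∣_∣; Nonempty)
import Data.Integer.Base as ℤ
open ℤ using (ℤ; +_; _%ℕ_)
open import Data.List.Base using (List; []; _∷_; length; map)
open import Data.List.Extrema.Nat using (min)
import Data.List.Membership.Propositional as List
import Data.List.Membership.DecPropositional as DecList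
open import Data.List.Relation.Unary.Unique.Propositional using (Unique)
open import Data.Nat.Base using (ℕ; suc; _⊓_)
import Data.Nat.Properties as ℕ
open import Data.Product.Base using (Σ; ∃; ∃-syntax; _×_)
open import Data.Rational.Base as ℚ using (ℚ; 0ℚ; 1ℚ; _/_)
open import Data.Sum.Base using (_⊎_)
open import Data.Vec.Base using (tabulate)
open import Function.Base using (_∘_)
open import Function.Bundles using (_⇔_)
open import Function.Definitions using (Injective)
open import Relation.Binary.PropositionalEquality.Core using (_≡_; _≢_)
open import Relation.Nullary.Decidable using (Dec; does; from-yes; ¬?; _→-dec_)
open import Relation.Nullary.Negation.Core using (¬_)

-- Dedekind reals: lower q means q < x, and upper q means x < q.
record ℝ : Set₁ where
  field
    lower upper   : ℚ → Set
    lower-inhab   : ∃ lower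
    upper-inhab   : ∃ upper
    lower-rounded : ∀ q → lower q ⇔ (∃[ r ] q ℚ.< r × lower r)
    upper-rounded : ∀ q → upper q ⇔ (∃[ r ] r ℚ.< q × upper r)
    disjoint      : ∀ q → ¬ (lower q × upper q)
    located       : ∀ q r → q ℚ.< r → lower q ⊎ upper r

Positive : ℝ → Set
Positive x = ℝ.lower x 0ℚ

LessThanOne : ℝ → Set
LessThanOne x = ℝ.upper x 1ℚ

fromℕ : ℕ → ℚ
fromℕ n = + n / 1

-- x m ≤ k, since x m = sup { q m : q < x } for a natural number m.
_·_≤_ : ℝ → ℕ → ℕ → Set
x · m ≤ k = ∀ q → ℝ.lower x q → q ℚ.* fromℕ m ℚ.≤ fromℕ k

-- m ≥ 1/x for positive x, in the form 1 ≤ x m, where x m = inf { q m : x < q }.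
_≥1/_ : ℕ → ℝ → Set
m ≥1/ x = ∀ q → ℝ.upper x q → 1ℚ ℚ.≤ q ℚ.* fromℕ m

record Tournament (n : ℕ) : Set where
  field
    edge       : Fin n → Fin n → Bool
    loopless   : ∀ v → edge v v ≡ false
    exactlyOne : ∀ u v → u ≢ v → T (edge u v xor edge v u)

open Tournament public

outdegree : ∀ {n} → Tournament n → Fin n → ℕ
outdegree G v = ∣ tabulate (edge G v) ∣

record PurePair {n} (G : Tournament n) : Set where
  field
    A B      : Subset n
    disjoint : ∀ v → v ∈ A → v ∉ B
    complete : ∀ a b → a ∈ A → b ∈ B → edge G a b ≡ true

  order : ℕ
  order = ∣ A ∣ ⊓ ∣ B ∣

-- A blockade in Fin n.  The index set I is a duplicate-free list, and the
-- values of block outside I are irrelevant.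
record Blockade (n : ℕ) : Set where
  field
    I          : List ℤ
    I-unique   : Unique I
    block      : ℤ → Subset n
    nonempty   : ∀ i → i List.∈ I → Nonempty (block i)
    disjoint   : ∀ i j → i List.∈ I → j List.∈ I → i ≢ j →
                 ∀ v → v ∈ block i → v ∉ block j

  blockadeLength : ℕ
  blockadeLength = length I

  -- Blocks have at most n elements, so the default value n of min does not
  -- affect the minimum when I is nonempty.
  width : ℕ
  width = min n (map (∣_∣ ∘ block) I)

open Blockade public using (blockadeLength; width)

-- The subtournament of G induced on X is isomorphic to H; f is the
-- isomorphism, a bijection from V(H) onto X.
record IsCopy {k n} (H : Tournament k) (G : Tournament n) (X : Subset n) : Set where
  field
    f         : Fin k → Fin n
    injective : Injective _≡_ _≡_ f
    image     : ∀ v → v ∈ X ⇔ (∃[ i ] f i ≡ v)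
    edges     : ∀ i j → edge H i j ≡ edge G (f i) (f j)

IsRainbow : ∀ {n} → Blockade n → Subset n → Set
IsRainbow 𝓑 X =
    (∀ v → v ∈ X → ∃[ i ] i List.∈ I × v ∈ block i)
  × (∀ u v i → u ∈ X → v ∈ X → u ≢ v → i List.∈ I → ¬ (u ∈ block i × v ∈ block i))
  where open Blockade 𝓑

RainbowCopy : ∀ {k n} → Tournament k → Tournament n → Blockade n → Set
RainbowCopy H G 𝓑 = ∃[ X ] IsCopy H G X × IsRainbow 𝓑 X

PurePairOfOrderAtLeast : ∀ {n} → ℝ → Tournament n → Blockade n → Set
PurePairOfOrderAtLeast c G 𝓑 =
  Σ (PurePair G) λ P → c · width 𝓑 ≤ PurePair.order P

RSEH : ∀ {k} → Tournament k → Set₁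
RSEH H = Σ ℝ λ c → Positive c × LessThanOne c ×
  (∀ n (G : Tournament n) (𝓑 : Blockade n) →
     blockadeLength 𝓑 ≥1/ c →
     ¬ RainbowCopy H G 𝓑 →
     PurePairOfOrderAtLeast c G 𝓑)

circulantEdge : ∀ n → List ℕ → Fin (suc n) → Fin (suc n) → Bool
circulantEdge n S i j = does (((+ toℕ j ℤ.- + toℕ i) %ℕ suc n) ∈? S)
  where open DecList ℕ._≟_ using (_∈?_)

private
  loopless? : ∀ {n} (e : Fin n → Fin n → Bool) → Dec (∀ v → e v v ≡ false)
  loopless? e = all? λ v → e v v Bool.≟ false

  exactlyOne? : ∀ {n} (e : Fin n → Fin n → Bool) →
                Dec (∀ u v → u ≢ v → T (e u v xor e v u))
  exactlyOne? e = all? λ u → all? λ v → ¬? (u ≟ v) →-dec T? (e u v xor e v u)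

-- The tournament on five vertices with all outdegrees two, unique up to
-- isomorphism, represented as a circulant; see D₅-outdegree.
D₅ : Tournament 5
D₅ = record
  { edge       = e
  ; loopless   = from-yes (loopless? e)
  ; exactlyOne = from-yes (exactlyOne? e)
  }
  where e = circulantEdge 4 (1 ∷ 2 ∷ [])

D₅-outdegree : ∀ v → outdegree D₅ v ≡ 2
D₅-outdegree = from-yes (all? λ v → outdegree D₅ v ℕ.≟ 2)

-- Vertices are numbered from 0 rather than 1; only differences matter.
P₇ : Tournament 7
P₇ = record
  { edge       = e
  ; loopless   = from-yes (loopless? e)
  ; exactlyOne = from-yes (exactlyOne? e)
  }
  where e = circulantEdge 6 (1 ∷ 2 ∷ 4 ∷ [])

deleteVertex : ∀ {n} → Fin (suc n) → Tournament (suc n) → Tournament n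
deleteVertex x G = record
  { edge       = λ u v → edge G (punchIn x u) (punchIn x v)
  ; loopless   = λ v → loopless G (punchIn x v)
  ; exactlyOne = λ u v u≢v →
      exactlyOne G (punchIn x u) (punchIn x v) (u≢v ∘ punchIn-injective x u v)
  }

-- P₇ is vertex-transitive, so the choice of the deleted vertex is immaterial.
P₇⁻ : Tournament 6
P₇⁻ = deleteVertex 6F P₇

module Submission where

-- Let σ add the all-ones word on ℤ₃ᵈ, so that σ³ = id and σ moves every word
-- as far as possible in the Hamming metric δ.  Take K copies of ℤ₃ᵈ as blocks,
-- one after another, and orient every pair forward except that v → u for u
-- before v whenever v is close to σ u, at a radius that depends on the two
-- blocks and grows steeply.
--
-- Large sets X and Y always contain x and y with y close to σ x: a 1-Lipschitz
-- function on ℤ₃ᵈ has Σ (f x − f y)² ≤ d 9ᵈ, and this is applied to the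
-- distance from σ X.  This excludes large pure pairs, of either direction,
-- because closeness of y to σ x and of x to σ y would give σ² ≈ id.
--
-- For vertices a < b < c < d in distinct blocks, adding up the shifts (which
-- must agree modulo 3) and comparing radii excludes four patterns of backward
-- pairs.  Every ordering of the vertices of D₅ or P₇⁻ contains one of them,
-- which is checked by a search.

open import Defs
open import Data.Bool.Base using (Bool; true; false; T; not; if_then_else_; _∧_; _∨_; _xor_)
open import Data.Bool.ListAction using (all)
open import Data.Bool.Properties using (T-∧; T-∨; T-≡)
open import Data.Empty using (⊥)
open import Data.Fin.Base as Fin
  using (Fin; zero; suc; toℕ; _↑ˡ_; _↑ʳ_; combine; quotient; remainder; finToFun; funToFin)
open import Data.Fin.Patterns using (0F; 1F; 2F)
open import Data.Fin.Permutation using (Permutation; permutation)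
import Data.Fin.Properties as Fin
open import Data.Fin.Subset using (Subset; ∣_∣; _∈_)
open import Data.Integer.Base as ℤ using (ℤ)
import Data.Integer.Properties as ℤ
open import Data.List.Base as List using (List; []; _∷_; allFin)
open import Data.List.Extrema.Nat using (min; min≤xs; min≤⊤; v≤min⁺)
import Data.List.Membership.Propositional as List
open import Data.List.Membership.Propositional.Properties using (∈-map⁺; ∈-tabulate⁺; ∈-tabulate⁻)
import Data.List.Properties as List
open import Data.List.Relation.Binary.Permutation.Propositional
  using (_↭_; prep; swap; ↭-refl; ↭-trans; ↭-sym)
open import Data.List.Relation.Binary.Permutation.Propositional.Properties using (All-resp-↭)
open import Data.List.Relation.Unary.All as All using (All; []; _∷_)
import Data.List.Relation.Unary.All.Properties as All
open import Data.List.Relation.Unary.AllPairs as AllPairs using (AllPairs; []; _∷_)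
open import Data.List.Relation.Unary.Any using (here; there)
import Data.List.Relation.Unary.Unique.Propositional.Properties as Unique
open import Data.Nat.Base
  using (ℕ; zero; suc; _+_; _*_; _∸_; _^_; _≤_; _<_; _≥_; z≤n; s≤s; ∣_-_∣; NonZero)
import Data.Nat.Properties as ℕ
open import Data.Nat.Tactic.RingSolver using (solve-∀)
open import Data.Product.Base using (Σ; _×_; _,_; ∃-syntax; proj₁; map₂)
open import Data.Rational.Base as ℚ using (ℚ; mkℚ; 0ℚ; 1ℚ; toℚᵘ)
import Data.Rational.Properties as ℚ
open import Data.Rational.Unnormalised.Base as ℚᵘ using (mkℚᵘ)
import Data.Rational.Unnormalised.Properties as ℚᵘ
open import Data.Sum.Base using (_⊎_; inj₁; inj₂)
open import Data.Unit.Base using (tt)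
open import Data.Vec.Base using ([]; _∷_; lookup; tabulate)
open import Data.Vec.Properties using (lookup∘tabulate; []=⇒lookup; lookup⇒[]=)
open import Function.Base using (_∘_; _on_)
open import Function.Bundles using (Equivalence)
open import Relation.Binary.Definitions using (tri<; tri≈; tri>)
open import Relation.Binary.PropositionalEquality
  using (_≡_; _≢_; _≗_; refl; sym; trans; cong; cong₂; subst; subst₂)
open import Relation.Nullary.Decidable using (yes; no; does; ⌊_⌋; toWitness; fromWitness)
open import Relation.Nullary.Negation using (¬_; contradiction)

open import Algebra.Properties.Semiring.Sum ℕ.+-*-semiring
  using (sum; sum-syntax; sum-cong-≗; ∑-distrib-+; ∑-comm; *-distribˡ-sum; *-distribʳ-sum; sum-permute)

-- Finite sums of natural numbers.

sum-mono-≤ : ∀ {n} {f g : Fin n → ℕ} → (∀ i → f i ≤ g i) → sum f ≤ sum g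
sum-mono-≤ {zero}  f≤g = z≤n
sum-mono-≤ {suc n} f≤g = ℕ.+-mono-≤ (f≤g zero) (sum-mono-≤ (f≤g ∘ suc))

sum-const : ∀ n c → ∑[ _ < n ] c ≡ n * c
sum-const zero    c = refl
sum-const (suc n) c = cong (c +_) (sum-const n c)

sum-↑ : ∀ m {n} (f : Fin (m + n) → ℕ) → sum f ≡ ∑[ i < m ] f (i ↑ˡ n) + ∑[ j < n ] f (m ↑ʳ j)
sum-↑ zero    f = refl
sum-↑ (suc m) f = trans (cong (f zero +_) (sum-↑ m (f ∘ suc))) (sym (ℕ.+-assoc (f zero) _ _))

sum-combine : ∀ m {n} (f : Fin (m * n) → ℕ) → sum f ≡ ∑[ i < m ] ∑[ j < n ] f (combine i j)
sum-combine zero        f = refl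
sum-combine (suc m) {n} f = trans (sum-↑ n f) (cong (sum (f ∘ (_↑ˡ m * n)) +_) (sum-combine m (f ∘ (n ↑ʳ_))))

sum-*-sum : ∀ {m n} (f : Fin m → ℕ) (g : Fin n → ℕ) →
            ∑[ i < m ] ∑[ j < n ] (f i * g j) ≡ sum f * sum g
sum-*-sum f g = trans (sum-cong-≗ λ i → sym (*-distribˡ-sum (f i) g)) (sym (*-distribʳ-sum (sum g) f))

term≤sum : ∀ {n} (f : Fin n → ℕ) i → f i ≤ sum f
term≤sum f zero    = ℕ.m≤m+n (f zero) _
term≤sum f (suc i) = ℕ.m≤n⇒m≤o+n (f zero) (term≤sum (f ∘ suc) i)

sum≤n*max : ∀ {n} .{{_ : NonZero n}} (f : Fin n → ℕ) → ∃[ i ] sum f ≤ n * f i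
sum≤n*max {suc zero}    f = zero , ℕ.≤-refl
sum≤n*max {suc (suc n)} f with sum≤n*max (f ∘ suc)
... | i , le with ℕ.≤-total (f zero) (f (suc i))
...   | inj₁ 0≤i = suc i , ℕ.+-mono-≤ 0≤i le
...   | inj₂ i≤0 = zero , ℕ.+-monoʳ-≤ (f zero) (ℕ.≤-trans le (ℕ.*-monoʳ-≤ (suc n) i≤0))

-- Squared differences and energy.

sq : ℕ → ℕ → ℕ
sq m n = ∣ m - n ∣ * ∣ m - n ∣

-- With t = m - n this is (t - 1)² + (t + 1)² = 2 t² + 2.
sq-parallelogram : ∀ m n → sq m (suc n) + sq (suc m) n ≡ sq m n + sq m n + 2
sq-parallelogram zero    zero    = refl
sq-parallelogram zero    (suc n) = eq n
  where
  eq : ∀ n → suc (suc n) * suc (suc n) + n * n ≡ suc n * suc n + suc n * suc n + 2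
  eq = solve-∀
sq-parallelogram (suc m) (suc n) = sq-parallelogram m n
sq-parallelogram (suc m) zero    = eq m
  where
  eq : ∀ n → ∣ n - 0 ∣ * ∣ n - 0 ∣ + suc (suc n) * suc (suc n) ≡ suc n * suc n + suc n * suc n + 2
  eq n rewrite ℕ.∣-∣-identityʳ n = eq′ n
    where
    eq′ : ∀ n → n * n + suc (suc n) * suc (suc n) ≡ suc n * suc n + suc n * suc n + 2
    eq′ = solve-∀

adjacent : ∀ {m n} → m ≤ suc n → n ≤ suc m → m ≡ n ⊎ m ≡ suc n ⊎ n ≡ suc m
adjacent {zero}  {zero}        _ _ = inj₁ refl
adjacent {zero}  {suc zero}    _ _ = inj₂ (inj₂ refl)
adjacent {zero}  {suc (suc n)} _ (s≤s ())
adjacent {suc zero} {zero}        _ _ = inj₂ (inj₁ refl)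
adjacent {suc (suc m)} {zero}     (s≤s ()) _
adjacent {suc m} {suc n} (s≤s p) (s≤s q) with adjacent p q
... | inj₁ e        = inj₁ (cong suc e)
... | inj₂ (inj₁ e) = inj₂ (inj₁ (cong suc e))
... | inj₂ (inj₂ e) = inj₂ (inj₂ (cong suc e))

-- (p − v)² + (q − u)² = (p − u)² + (q − v)² + 2 (p − q)(u − v).
sq-exchange : ∀ {p q u v} → p ≤ suc q → q ≤ suc p → u ≤ suc v → v ≤ suc u →
              sq p v + sq q u ≤ sq p u + sq q v + 2
sq-exchange {p} {q} {u} {v} a b c d with adjacent a b | adjacent c d
... | inj₁ refl        | _                = ℕ.m≤n⇒m≤n+o 2 (ℕ.≤-reflexive (ℕ.+-comm (sq p v) (sq p u)))
... | _                | inj₁ refl        = ℕ.m≤m+n _ 2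
... | inj₂ (inj₁ refl) | inj₂ (inj₁ refl) = down q v
  where
  down : ∀ q v → sq (suc q) v + sq q (suc v) ≤ sq q v + sq q v + 2
  down q v = ℕ.≤-reflexive (trans (ℕ.+-comm (sq (suc q) v) _) (sq-parallelogram q v))
... | inj₂ (inj₁ refl) | inj₂ (inj₂ refl) = up q u
  where
  up : ∀ q u → sq q u + sq q u ≤ sq (suc q) u + sq q (suc u) + 2
  up q u rewrite ℕ.+-comm (sq (suc q) u) (sq q (suc u)) | sq-parallelogram q u =
    ℕ.m≤n⇒m≤n+o 2 (ℕ.m≤m+n _ 2)
... | inj₂ (inj₂ refl) | inj₂ (inj₁ refl) = up p v
  where
  up : ∀ p v → sq p v + sq p v ≤ sq p (suc v) + sq (suc p) v + 2
  up p v rewrite sq-parallelogram p v = ℕ.m≤n⇒m≤n+o 2 (ℕ.m≤m+n _ 2)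
... | inj₂ (inj₂ refl) | inj₂ (inj₂ refl) = ℕ.≤-reflexive (sq-parallelogram p u)

-- Two functions are allowed because the induction on the dimension compares two slices of a single
-- function.
energy : ∀ {n} → (Fin n → ℕ) → (Fin n → ℕ) → ℕ
energy {n} f g = ∑[ x < n ] ∑[ y < n ] sq (f x) (g y)

∑∑-distrib-+ : ∀ {m n} (f g : Fin m → Fin n → ℕ) →
  ∑[ i < m ] ∑[ j < n ] (f i j + g i j) ≡ ∑[ i < m ] ∑[ j < n ] f i j + ∑[ i < m ] ∑[ j < n ] g i j
∑∑-distrib-+ f g = trans (sum-cong-≗ λ i → ∑-distrib-+ (f i) (g i)) (∑-distrib-+ (sum ∘ f) (sum ∘ g))

∑∑-const : ∀ m n c → ∑[ _ < m ] ∑[ _ < n ] c ≡ m * (n * c)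
∑∑-const m n c = trans (sum-const m _) (cong (m *_) (sum-const n c))

-- Summing `sq-exchange` over all pairs of points: mixed energies exceed the pure ones by at most 2
-- for each pair.
energy-exchange : ∀ {n} (f g : Fin n → ℕ) → (∀ x → f x ≤ suc (g x)) → (∀ x → g x ≤ suc (f x)) →
                  energy f g + energy g f ≤ energy f f + energy g g + n * (n * 2)
energy-exchange {n} f g f≤g g≤f = begin
  energy f g + energy g f
    ≡⟨ ∑∑-distrib-+ (λ x y → sq (f x) (g y)) (λ x y → sq (g x) (f y)) ⟨
  ∑[ x < n ] ∑[ y < n ] (sq (f x) (g y) + sq (g x) (f y))
    ≤⟨ (sum-mono-≤ λ x → sum-mono-≤ λ y → sq-exchange (f≤g x) (g≤f x) (f≤g y) (g≤f y)) ⟩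
  ∑[ x < n ] ∑[ y < n ] (sq (f x) (f y) + sq (g x) (g y) + 2)
    ≡⟨ ∑∑-distrib-+ (λ x y → sq (f x) (f y) + sq (g x) (g y)) (λ _ _ → 2) ⟩
  ∑[ x < n ] ∑[ y < n ] (sq (f x) (f y) + sq (g x) (g y)) + ∑[ x < n ] ∑[ y < n ] 2
    ≡⟨ cong₂ _+_ (∑∑-distrib-+ (λ x y → sq (f x) (f y)) (λ x y → sq (g x) (g y))) (∑∑-const n n 2) ⟩
  energy f f + energy g g + n * (n * 2) ∎
  where open ℕ.≤-Reasoning

-- The Hamming metric on words.

differ : ∀ {m} → Fin m → Fin m → ℕ
differ a b = if does (a Fin.≟ b) then 0 else 1

differ-≤1 : ∀ {m} (a b : Fin m) → differ a b ≤ 1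
differ-≤1 a b with does (a Fin.≟ b)
... | true  = z≤n
... | false = ℕ.≤-refl

differ-refl : ∀ {m} (a : Fin m) → differ a a ≡ 0
differ-refl a with a Fin.≟ a
... | yes _ = refl
... | no a≢a = contradiction refl a≢a

differ-sym : ∀ {m} (a b : Fin m) → differ a b ≡ differ b a
differ-sym a b with a Fin.≟ b | b Fin.≟ a
... | yes _   | yes _   = refl
... | yes a≡b | no b≢a  = contradiction (sym a≡b) b≢a
... | no a≢b  | yes b≡a = contradiction (sym b≡a) a≢b
... | no _    | no _    = refl

differ-triangle : ∀ {m} (a b c : Fin m) → differ a c ≤ differ a b + differ b c
differ-triangle a b c with a Fin.≟ b | b Fin.≟ c
... | yes refl | yes refl = ℕ.≤-reflexive (differ-refl a)
... | yes refl | no _     = differ-≤1 a c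
... | no _     | yes _    = differ-≤1 a c
... | no _     | no _     = ℕ.≤-trans (differ-≤1 a c) (s≤s z≤n)

Word : ℕ → ℕ → Set
Word m d = Fin d → Fin m

hamming : ∀ {m d} → Word m d → Word m d → ℕ
hamming {d = d} u v = ∑[ i < d ] differ (u i) (v i)

hamming-refl : ∀ {m d} (u : Word m d) → hamming u u ≡ 0
hamming-refl {d = d} u = trans (sum-cong-≗ (differ-refl ∘ u)) (trans (sum-const d 0) (ℕ.*-zeroʳ d))

hamming-sym : ∀ {m d} (u v : Word m d) → hamming u v ≡ hamming v u
hamming-sym u v = sum-cong-≗ λ i → differ-sym (u i) (v i)

hamming-triangle : ∀ {m d} (u v w : Word m d) → hamming u w ≤ hamming u v + hamming v w
hamming-triangle u v w = ℕ.≤-trans (sum-mono-≤ λ i → differ-triangle (u i) (v i) (w i))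
  (ℕ.≤-reflexive (∑-distrib-+ (λ i → differ (u i) (v i)) (λ i → differ (v i) (w i))))

-- Points are numbers below m ^ d, so that sets of points and sums over them are indexed by `Fin`;
-- this decodes the letters.
word : ∀ {m} d → Fin (m ^ d) → Word m d
word d = finToFun

δ : ∀ {m} d → Fin (m ^ d) → Fin (m ^ d) → ℕ
δ d x y = hamming (word d x) (word d y)

δ-sym : ∀ {m} d (x y : Fin (m ^ d)) → δ d x y ≡ δ d y x
δ-sym d x y = hamming-sym (word d x) (word d y)

δ-triangle : ∀ {m} d (x y z : Fin (m ^ d)) → δ d x z ≤ δ d x y + δ d y z
δ-triangle d x y z = hamming-triangle (word d x) (word d y) (word d z)

-- `finToFun` reads the first letter by `remQuot`, which undoes `combine`, so the first term of the
-- Hamming sum splits off.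
δ-combine : ∀ {m} d (a b : Fin m) (x y : Fin (m ^ d)) →
            δ {m} (suc d) (combine a x) (combine b y) ≡ differ a b + δ d x y
δ-combine d a b x y = cong₂
  (λ (a , x) (b , y) → differ a b + δ d x y)
  (Fin.remQuot-combine a x) (Fin.remQuot-combine b y)

-- The energy inequality for Lipschitz functions.

Lipschitz : ∀ {m} d → (Fin (m ^ d) → ℕ) → Set
Lipschitz d f = ∀ x y → f x ≤ δ d x y + f y

double-≤ : ∀ {a b} → a + a ≤ b + b → a ≤ b
double-≤ {a} {b} le = ℕ.≮⇒≥ λ b<a → ℕ.<⇒≱ (ℕ.+-mono-< b<a b<a) le

-- A form of the Efron-Stein inequality: the variance is at most d / 2. By induction on d, slicing
-- by the first letter: two slices differ by at most 1 pointwise, so `energy-exchange` reduces their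
-- mixed energies to the energies of single slices.
energy-Lipschitz : ∀ {m} d (f : Fin (m ^ d) → ℕ) → Lipschitz d f →
                   energy f f ≤ d * (m ^ d * m ^ d)
energy-Lipschitz {m} zero    f _   = ℕ.≤-reflexive (cong (λ z → z * z + 0 + 0) (ℕ.∣n-n∣≡0 (f zero)))
-- The energy is doubled because `pair` bounds only the sum of the mixed energies in both orders;
-- `∑-comm` swaps the letters in the second copy.
energy-Lipschitz {m} (suc d) f lip = double-≤ (begin
  energy f f + energy f f ≡⟨ cong (λ e → e + e) split ⟩
  ∑[ a < m ] ∑[ b < m ] energy (f′ a) (f′ b) + ∑[ a < m ] ∑[ b < m ] energy (f′ a) (f′ b)
    ≡⟨ cong (∑[ a < m ] ∑[ b < m ] energy (f′ a) (f′ b) +_) (∑-comm λ a b → energy (f′ a) (f′ b)) ⟩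
  ∑[ a < m ] ∑[ b < m ] energy (f′ a) (f′ b) + ∑[ a < m ] ∑[ b < m ] energy (f′ b) (f′ a)
    ≡⟨ ∑∑-distrib-+ (λ a b → energy (f′ a) (f′ b)) (λ a b → energy (f′ b) (f′ a)) ⟨
  ∑[ a < m ] ∑[ b < m ] (energy (f′ a) (f′ b) + energy (f′ b) (f′ a))
    ≤⟨ (sum-mono-≤ λ a → sum-mono-≤ λ b → pair a b) ⟩
  ∑[ a < m ] ∑[ b < m ] (d * (M * M) + d * (M * M) + M * (M * 2))
    ≡⟨ ∑∑-const m m _ ⟩
  m * (m * (d * (M * M) + d * (M * M) + M * (M * 2)))
    ≡⟨ arith m d M ⟩
  suc d * (m * M * (m * M)) + suc d * (m * M * (m * M)) ∎)
  where
  open ℕ.≤-Reasoning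
  M = m ^ d

  f′ : Fin m → Fin M → ℕ
  f′ a x = f (combine a x)

  split : energy f f ≡ ∑[ a < m ] ∑[ b < m ] energy (f′ a) (f′ b)
  split = trans (sum-combine m (λ x → ∑[ y < m * M ] sq (f x) (f y))) (sum-cong-≗ λ a →
    trans (sum-cong-≗ λ x → sum-combine m (sq (f′ a x) ∘ f))
          (∑-comm λ x b → ∑[ y < M ] sq (f′ a x) (f′ b y)))

  near : ∀ a b x → f′ a x ≤ suc (f′ b x)
  near a b x = begin
    f′ a x ≤⟨ lip (combine a x) (combine b x) ⟩
    δ {m} (suc d) (combine a x) (combine b x) + f′ b x
      ≡⟨ cong (_+ f′ b x) (trans (δ-combine d a b x x) (cong (differ a b +_) (hamming-refl (word d x)))) ⟩
    differ a b + 0 + f′ b x ≤⟨ ℕ.+-monoˡ-≤ (f′ b x) (ℕ.+-monoˡ-≤ 0 (differ-≤1 a b)) ⟩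
    suc (f′ b x) ∎

  ih : ∀ a → energy (f′ a) (f′ a) ≤ d * (M * M)
  ih a = energy-Lipschitz d (f′ a) λ x y →
    subst (λ e → f′ a x ≤ e + f′ a y)
          (trans (δ-combine d a a x y) (cong (_+ δ d x y) (differ-refl a)))
          (lip (combine a x) (combine a y))

  pair : ∀ a b → energy (f′ a) (f′ b) + energy (f′ b) (f′ a) ≤ d * (M * M) + d * (M * M) + M * (M * 2)
  pair a b = ℕ.≤-trans (energy-exchange (f′ a) (f′ b) (near a b) (near b a))
    (ℕ.+-monoˡ-≤ (M * (M * 2)) (ℕ.+-mono-≤ (ih a) (ih b)))

  arith : ∀ m d M → m * (m * (d * (M * M) + d * (M * M) + M * (M * 2))) ≡
                    suc d * (m * M * (m * M)) + suc d * (m * M * (m * M))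
  arith = solve-∀

-- Sets of words that are far apart.

𝟙 : Bool → ℕ
𝟙 b = if b then 1 else 0

count : ∀ {n} → (Fin n → Bool) → ℕ
count X = sum (𝟙 ∘ X)

∣∣≡count : ∀ {n} (A : Subset n) → ∣ A ∣ ≡ count (lookup A)
∣∣≡count []          = refl
∣∣≡count (true  ∷ A) = cong suc (∣∣≡count A)
∣∣≡count (false ∷ A) = ∣∣≡count A

-- The distance from X, capped at r. Points outside X receive the value r, which is neutral for this
-- minimum.
dist : ∀ {m} d → (Fin (m ^ d) → Bool) → ℕ → Fin (m ^ d) → ℕ
dist d X r y = min r (List.tabulate λ x → if X x then δ d x y else r)

dist-≤ : ∀ {m} d (X : Fin (m ^ d) → Bool) r x y → T (X x) → dist d X r y ≤ δ d x y
dist-≤ {m} d X r x y x∈X with X x | All.tabulate⁻ {f = g} (min≤xs r (List.tabulate g)) x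
  where
  g : Fin (m ^ d) → ℕ
  g x = if X x then δ d x y else r
... | true | le = le

dist-glb : ∀ {m} d (X : Fin (m ^ d) → Bool) {r k} y → k ≤ r → (∀ x → T (X x) → k ≤ δ d x y) →
           k ≤ dist d X r y
dist-glb d X {r} {k} y k≤r k≤δ = v≤min⁺ k≤r (All.tabulate⁺ below)
  where
  below : ∀ x → k ≤ (if X x then δ d x y else r)
  below x with X x | k≤δ x
  ... | true  | le = le _
  ... | false | _  = k≤r

-- By the triangle inequality, no point of X is nearer to z than `dist d X r y` ∸ `δ d y z`; this
-- difference is also at most the cap.
dist-Lipschitz : ∀ {m} d (X : Fin (m ^ d) → Bool) r → Lipschitz d (dist d X r)
dist-Lipschitz d X r y z = ℕ.≤-trans (ℕ.m≤n+m∸n _ (δ d y z)) (ℕ.+-monoʳ-≤ (δ d y z)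
  (dist-glb d X z
    (ℕ.≤-trans (ℕ.m∸n≤m _ (δ d y z)) (min≤⊤ r (List.tabulate λ x → if X x then δ d x y else r)))
    λ x x∈X → ℕ.m≤n+o⇒m∸n≤o _ (δ d y z) (begin
      dist d X r y      ≤⟨ dist-≤ d X r x y x∈X ⟩
      δ d x y           ≤⟨ δ-triangle d x z y ⟩
      δ d x z + δ d z y ≡⟨ cong (δ d x z +_) (δ-sym d z y) ⟩
      δ d x z + δ d y z ≡⟨ ℕ.+-comm (δ d x z) _ ⟩
      δ d y z + δ d x z ∎)))
  where open ℕ.≤-Reasoning

-- The capped distance from X is 0 on X and at least r on Y, so each pair from X and Y adds at least
-- r * r to its energy.
separated-sets : ∀ {m} d (X Y : Fin (m ^ d) → Bool) r →
  (∀ x y → T (X x) → T (Y y) → r ≤ δ d x y) →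
  count X * count Y * (r * r) ≤ d * (m ^ d * m ^ d)
separated-sets {m} d X Y r far = begin
  count X * count Y * (r * r)
    ≡⟨ cong (_* (r * r)) (sum-*-sum (𝟙 ∘ X) (𝟙 ∘ Y)) ⟨
  (∑[ x < m ^ d ] ∑[ y < m ^ d ] (𝟙 (X x) * 𝟙 (Y y))) * (r * r)
    ≡⟨ *-distribʳ-sum (r * r) (λ x → ∑[ y < m ^ d ] (𝟙 (X x) * 𝟙 (Y y))) ⟩
  ∑[ x < m ^ d ] ((∑[ y < m ^ d ] (𝟙 (X x) * 𝟙 (Y y))) * (r * r))
    ≡⟨ (sum-cong-≗ λ x → *-distribʳ-sum (r * r) (λ y → 𝟙 (X x) * 𝟙 (Y y))) ⟩
  ∑[ x < m ^ d ] ∑[ y < m ^ d ] (𝟙 (X x) * 𝟙 (Y y) * (r * r))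
    ≤⟨ (sum-mono-≤ λ x → sum-mono-≤ λ y → term x y) ⟩
  energy f f
    ≤⟨ energy-Lipschitz d f (dist-Lipschitz d X r) ⟩
  d * (m ^ d * m ^ d) ∎
  where
  open ℕ.≤-Reasoning
  f = dist d X r

  term : ∀ x y → 𝟙 (X x) * 𝟙 (Y y) * (r * r) ≤ sq (f x) (f y)
  term x y with X x in eqX | Y y in eqY
  ... | false | _     = z≤n
  ... | true  | false = z≤n
  ... | true  | true
    rewrite ℕ.n≤0⇒n≡0 (ℕ.≤-trans (dist-≤ d X r x x (subst T (sym eqX) _))
                                  (ℕ.≤-reflexive (hamming-refl (word d x))))
          | ℕ.+-identityʳ (r * r) =
    ℕ.*-mono-≤ r≤fy r≤fy
    where
    r≤fy : r ≤ f y
    r≤fy = dist-glb d X y ℕ.≤-refl λ x′ x′∈X → far x′ y x′∈X (subst T (sym eqY) _)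

-- The rotation σ.

rot : Fin 3 → Fin 3
rot 0F = 1F
rot 1F = 2F
rot 2F = 0F

rot³ : ∀ a → rot (rot (rot a)) ≡ a
rot³ 0F = refl
rot³ 1F = refl
rot³ 2F = refl

rot-injective : ∀ {a b} → rot a ≡ rot b → a ≡ b
rot-injective {a} {b} eq = trans (sym (rot³ a)) (trans (cong (rot ∘ rot) eq) (rot³ b))

rot≢ : ∀ a → a ≢ rot a
rot≢ 0F ()
rot≢ 1F ()
rot≢ 2F ()

differ-rot : ∀ a b → differ (rot a) (rot b) ≡ differ a b
differ-rot a b with rot a Fin.≟ rot b | a Fin.≟ b
... | yes _ | yes _    = refl
... | yes e | no a≢b   = contradiction (rot-injective e) a≢b
... | no ne | yes refl = contradiction refl ne
... | no _  | no _     = refl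

differ-rotʳ : ∀ a → differ a (rot a) ≡ 1
differ-rotʳ a with a Fin.≟ rot a
... | yes e = contradiction e (rot≢ a)
... | no _  = refl

funToFin-cong : ∀ {m d} {f g : Word m d} → f ≗ g → funToFin f ≡ funToFin g
funToFin-cong {d = zero}  f≗g = refl
funToFin-cong {d = suc d} f≗g = cong₂ combine (f≗g zero) (funToFin-cong (f≗g ∘ suc))

hamming-cong : ∀ {m d} {f f′ g g′ : Word m d} → f ≗ f′ → g ≗ g′ → hamming f g ≡ hamming f′ g′
hamming-cong p q = sum-cong-≗ λ i → cong₂ differ (p i) (q i)

σ : ∀ d → Fin (3 ^ d) → Fin (3 ^ d)
σ d x = funToFin (rot ∘ word d x)

word-σ : ∀ d x → word d (σ d x) ≗ rot ∘ word d x
word-σ d x = Fin.finToFun-funToFin (rot ∘ word d x)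

σ³ : ∀ d x → σ d (σ d (σ d x)) ≡ x
σ³ d x = trans (funToFin-cong λ i →
    trans (cong rot (trans (word-σ d (σ d x) i) (cong rot (word-σ d x i)))) (rot³ _))
  (Fin.funToFin-finToFin {d} x)

δ-σ : ∀ d x y → δ d (σ d x) (σ d y) ≡ δ d x y
δ-σ d x y = trans (hamming-cong (word-σ d x) (word-σ d y))
  (sum-cong-≗ {d} λ i → differ-rot (word d x i) (word d y i))

δ-σʳ : ∀ d x → δ d x (σ d x) ≡ d
δ-σʳ d x = trans (hamming-cong {f = word d x} (λ _ → refl) (word-σ d x))
  (trans (sum-cong-≗ {d} (differ-rotʳ ∘ word d x)) (trans (sum-const d 1) (ℕ.*-identityʳ d)))

-- Since σ³ = id, the image of X under σ is `X ∘ σ d ∘ σ d`. It has as many points as X, so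
-- `separated-sets` applies to it and Y.
rotated-sets-far : ∀ d (X Y : Fin (3 ^ d) → Bool) r →
  (∀ x y → T (X x) → T (Y y) → r ≤ δ d (σ d x) y) →
  count X * count Y * (r * r) ≤ d * (3 ^ d * 3 ^ d)
rotated-sets-far d X Y r far =
  subst (λ k → k * count Y * (r * r) ≤ d * (3 ^ d * 3 ^ d)) (sym (sum-permute (𝟙 ∘ X) π))
    (separated-sets d (X ∘ σ d ∘ σ d) Y r λ x y x∈ y∈ →
      subst (λ z → r ≤ δ d z y) (σ³ d x) (far (σ d (σ d x)) y x∈ y∈))
  where
  π : Permutation (3 ^ d) (3 ^ d)
  π = permutation (σ d ∘ σ d) (σ d) (σ³ d) (σ³ d)

-- The search for unavoidable patterns.

insertions : ∀ {A : Set} → A → List A → List (List A)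
insertions v []       = (v ∷ []) ∷ []
insertions v (x ∷ xs) = (v ∷ x ∷ xs) ∷ List.map (x ∷_) (insertions v xs)

-- Placing v before the first larger element shows that the sorted order is among those tried by the
-- search.
insertion-sorted : ∀ {A : Set} (pos : A → ℕ) v xs →
  AllPairs (_<_ on pos) xs → All (λ x → pos v ≢ pos x) xs →
  ∃[ ys ] ys List.∈ insertions v xs × ys ↭ v ∷ xs × AllPairs (_<_ on pos) ys
insertion-sorted pos v []       _             _         = _ , here refl , ↭-refl , [] ∷ []
insertion-sorted pos v (x ∷ xs) (x<xs ∷ xs<) (v≢x ∷ v≢xs) with ℕ.<-cmp (pos v) (pos x)
... | tri< v<x _ _ = _ , here refl , ↭-refl ,
                     (v<x ∷ All.map (ℕ.<-trans v<x) x<xs) ∷ x<xs ∷ xs<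
... | tri≈ _ v≡x _ = contradiction v≡x v≢x
... | tri> _ _ x<v with insertion-sorted pos v xs xs< v≢xs
...   | ys , ys∈ , ys↭ , ys< = x ∷ ys , there (∈-map⁺ (x ∷_) ys∈) ,
          ↭-trans (prep x ys↭) (swap x v ↭-refl) ,
          All-resp-↭ (↭-sym ys↭) (x<v ∷ x<xs) ∷ ys<

module Patterns {A : Set} (back : A → A → Bool) where

  pattern₃ : A → A → A → Bool
  pattern₃ a b c = back a b ∧ back b c ∧ back a c

  -- The first is a 4-cycle of backward pairs. In the other two, three backward pairs form a path
  -- between the ends of a pair that is not backward: c, a, b, d and b, d, a, c. Pairs not named are
  -- free.
  pattern₄ : A → A → A → A → Bool
  pattern₄ a b c d =
      (back a b ∧ back b c ∧ back c d ∧ back a d)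
    ∨ (back a b ∧ back a c ∧ back b d ∧ not (back c d))
    ∨ (back a c ∧ back a d ∧ back b d ∧ not (back b c))

  contains₃ : A → A → A → List A → Bool
  contains₃ a b c []       = pattern₃ a b c
  contains₃ a b c (d ∷ ds) = pattern₄ a b c d ∨ contains₃ a b c ds

  contains₂ : A → A → List A → Bool
  contains₂ a b []       = false
  contains₂ a b (c ∷ cs) = contains₃ a b c cs ∨ contains₂ a b cs

  contains₁ : A → List A → Bool
  contains₁ a []       = false
  contains₁ a (b ∷ bs) = contains₂ a b bs ∨ contains₁ a bs

  contains : List A → Bool
  contains []       = false
  contains (a ∷ as) = contains₁ a as ∨ contains as

  -- Tries every order of xs ++ vs that keeps the order of xs, and abandons an
  -- order as soon as its initial part contains a pattern.
  unavoidable : List A → List A → Bool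
  unavoidable xs []       = contains xs
  unavoidable xs (v ∷ vs) = contains xs ∨ all (λ ys → unavoidable ys vs) (insertions v xs)

  module _
    (pos : A → ℕ)
    (no₃ : ∀ a b c → pos a < pos b → pos b < pos c → ¬ T (pattern₃ a b c))
    (no₄ : ∀ a b c d → pos a < pos b → pos b < pos c → pos c < pos d → ¬ T (pattern₄ a b c d))
    where

    private
      Sorted : List A → Set
      Sorted = AllPairs (_<_ on pos)

    ¬T-∨ : ∀ {x y} → ¬ T x → ¬ T y → ¬ T (x ∨ y)
    ¬T-∨ ¬x ¬y t with Equivalence.to T-∨ t
    ... | inj₁ x = ¬x x
    ... | inj₂ y = ¬y y

    avoids₃ : ∀ {a b c} ds → pos a < pos b → pos b < pos c → All (λ d → pos c < pos d) ds →
              ¬ T (contains₃ a b c ds)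
    avoids₃ []       a<b b<c _            = no₃ _ _ _ a<b b<c
    avoids₃ (d ∷ ds) a<b b<c (c<d ∷ c<ds) =
      ¬T-∨ (no₄ _ _ _ d a<b b<c c<d) (avoids₃ ds a<b b<c c<ds)

    avoids₂ : ∀ {a b} cs → pos a < pos b → All (λ c → pos b < pos c) cs → Sorted cs →
              ¬ T (contains₂ a b cs)
    avoids₂ (c ∷ cs) a<b (b<c ∷ b<cs) (c<cs ∷ cs<) =
      ¬T-∨ (avoids₃ cs a<b b<c c<cs) (avoids₂ cs a<b b<cs cs<)

    avoids₁ : ∀ {a} bs → All (λ b → pos a < pos b) bs → Sorted bs → ¬ T (contains₁ a bs)
    avoids₁ (b ∷ bs) (a<b ∷ a<bs) (b<bs ∷ bs<) =
      ¬T-∨ (avoids₂ bs a<b b<bs bs<) (avoids₁ bs a<bs bs<)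

    avoids : ∀ xs → Sorted xs → ¬ T (contains xs)
    avoids (x ∷ xs) (x<xs ∷ xs<) = ¬T-∨ (avoids₁ xs x<xs xs<) (avoids xs xs<)

    -- Soundness of the search: the branch that inserts each v at its place under `pos` meets only
    -- sorted lists, and these contain no pattern.
    avoidable : ∀ xs vs → Sorted xs → All (λ v → All (λ x → pos v ≢ pos x) xs) vs →
                AllPairs (λ v w → pos v ≢ pos w) vs → ¬ T (unavoidable xs vs)
    avoidable xs []       xs< _ _ = avoids xs xs<
    avoidable xs (v ∷ vs) xs< (v≢xs ∷ vs≢xs) (v≢vs ∷ vs≢)
      with insertion-sorted pos v xs xs< v≢xs
    ... | ys , ys∈ , ys↭ , ys< = ¬T-∨ (avoids xs xs<) λ t →
      avoidable ys vs ys<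
        (All.zipWith (λ (w≢xs , v≢w) → All-resp-↭ (↭-sym ys↭) ((v≢w ∘ sym) ∷ w≢xs)) (vs≢xs , v≢vs))
        vs≢ (All.lookup (All.all⁺ (λ ys → unavoidable ys vs) _ t) ys∈)

-- When p is listed before q, the pair is backward if H has the edge from q to p. For a concrete H
-- the search is run by the type checker.
UnavoidablePattern : ∀ {k} → Tournament k → Set
UnavoidablePattern {k} H = T (Patterns.unavoidable (λ p q → edge H q p) [] (allFin k))

D₅-unavoidable : UnavoidablePattern D₅
D₅-unavoidable = tt

P₇⁻-unavoidable : UnavoidablePattern P₇⁻
P₇⁻-unavoidable = tt

-- Tournaments given by their backward pairs.

backedgeTournament : ∀ {n} → (Fin n → Fin n → Bool) → Tournament n
backedgeTournament {n} back = record { edge = e ; loopless = irrefl ; exactlyOne = one }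
  where
  e : Fin n → Fin n → Bool
  e u v with Fin.<-cmp u v
  ... | tri< _ _ _ = not (back u v)
  ... | tri≈ _ _ _ = false
  ... | tri> _ _ _ = back v u

  irrefl : ∀ v → e v v ≡ false
  irrefl v with Fin.<-cmp v v
  ... | tri< _ v≢v _ = contradiction refl v≢v
  ... | tri≈ _ _ _   = refl
  ... | tri> _ v≢v _ = contradiction refl v≢v

  one : ∀ u v → u ≢ v → T (e u v xor e v u)
  one u v u≢v with Fin.<-cmp u v | Fin.<-cmp v u
  ... | tri< u<v _ _ | tri< v<u _ _ = contradiction v<u (ℕ.<-asym u<v)
  ... | tri< _ _ _   | tri≈ _ v≡u _ = contradiction (sym v≡u) u≢v
  ... | tri≈ _ u≡v _ | _            = contradiction u≡v u≢v
  ... | tri> _ _ _   | tri≈ _ v≡u _ = contradiction (sym v≡u) u≢v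
  ... | tri> _ _ v<u | tri> _ _ u<v = contradiction v<u (ℕ.<-asym u<v)
  ... | tri< _ _ _   | tri> _ _ _ with back u v
  ...   | true  = _
  ...   | false = _
  one u v u≢v | tri> _ _ _ | tri< _ _ _ with back v u
  ...   | true  = _
  ...   | false = _

backedge : ∀ {n} (back : Fin n → Fin n → Bool) {u v} → u Fin.< v →
           edge (backedgeTournament back) v u ≡ back u v
backedge back {u} {v} u<v with Fin.<-cmp v u
... | tri< v<u _ _ = contradiction v<u (ℕ.<-asym u<v)
... | tri≈ _ v≡u _ = contradiction (sym v≡u) (Fin.<⇒≢ u<v)
... | tri> _ _ _   = refl

forward-edge : ∀ {n} (back : Fin n → Fin n → Bool) {u v} → u Fin.< v →
               edge (backedgeTournament back) u v ≡ not (back u v)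
forward-edge back {u} {v} u<v with Fin.<-cmp u v
... | tri< _ _ _   = refl
... | tri≈ _ u≡v _ = contradiction u≡v (Fin.<⇒≢ u<v)
... | tri> _ _ v<u = contradiction v<u (ℕ.<-asym u<v)

-- The radii and their growth.

module _ (K r₀ : ℕ) where

  -- Increasing in (i , −j) lexicographically: in the last two patterns the
  -- missing pair (i , j) must outweigh three pairs that are smaller in this order.
  exponent : ℕ → ℕ → ℕ
  exponent i j = i * K + (K ∸ j)

  radius : ℕ → ℕ → ℕ
  radius i j = r₀ * 3 ^ exponent i j

  -- The first index dominates because K ∸ j is at most K, while K ∸ l is positive.
  exponent-<ˡ : ∀ {i k} j {l} → i < k → l < K → exponent i j < exponent k l
  exponent-<ˡ {i} {k} j {l} i<k l<K = begin-strict
    i * K + (K ∸ j) ≤⟨ ℕ.+-monoʳ-≤ (i * K) (ℕ.m∸n≤m K j) ⟩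
    i * K + K       ≡⟨ ℕ.+-comm (i * K) K ⟩
    suc i * K       ≤⟨ ℕ.*-monoˡ-≤ K i<k ⟩
    k * K           <⟨ ℕ.m<m+n (k * K) (ℕ.m<n⇒0<n∸m l<K) ⟩
    k * K + (K ∸ l) ∎
    where open ℕ.≤-Reasoning

  exponent-<ʳ : ∀ i {j l} → j < l → l ≤ K → exponent i l < exponent i j
  exponent-<ʳ i j<l l≤K = ℕ.+-monoʳ-< (i * K) (ℕ.∸-monoʳ-< j<l l≤K)

  radius-≥ : ∀ i j → r₀ ≤ radius i j
  radius-≥ i j = ℕ.m≤m*n r₀ (3 ^ exponent i j) {{ℕ.m^n≢0 3 (exponent i j)}}

  radius-≤ : ∀ {i} j → i < K → radius i j ≤ r₀ * 3 ^ (K * K)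
  radius-≤ {i} j i<K = ℕ.*-monoʳ-≤ r₀ (ℕ.^-monoʳ-≤ 3 (begin
    i * K + (K ∸ j) ≤⟨ ℕ.+-monoʳ-≤ (i * K) (ℕ.m∸n≤m K j) ⟩
    i * K + K       ≡⟨ ℕ.+-comm (i * K) K ⟩
    suc i * K       ≤⟨ ℕ.*-monoˡ-≤ K i<K ⟩
    K * K           ∎))
    where open ℕ.≤-Reasoning

  -- This is why the radii grow by factors of 3: three smaller ones together fit into a larger one.
  three-powers : ∀ {a b c e} → a < e → b < e → c < e →
                 r₀ * 3 ^ a + (r₀ * 3 ^ b + r₀ * 3 ^ c) ≤ r₀ * 3 ^ e
  three-powers {e = suc e} (s≤s a≤e) (s≤s b≤e) (s≤s c≤e) = ℕ.≤-trans
    (ℕ.+-mono-≤ (mono a≤e) (ℕ.+-mono-≤ (mono b≤e) (mono c≤e)))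
    (ℕ.≤-reflexive (arith r₀ (3 ^ e)))
    where
    mono : ∀ {a} → a ≤ e → r₀ * 3 ^ a ≤ r₀ * 3 ^ e
    mono a≤e = ℕ.*-monoʳ-≤ r₀ (ℕ.^-monoʳ-≤ 3 a≤e)

    arith : ∀ r p → r * p + (r * p + r * p) ≡ r * (3 * p)
    arith = solve-∀

-- Excluding the four patterns.

module Rainbow (K r₀ d : ℕ) (small : 4 * (r₀ * 3 ^ (K * K)) < d) where

  private
    ρ = radius K r₀
    R = r₀ * 3 ^ (K * K)

    infixr 4 _⟨→⟩_
    _⟨→⟩_ : ∀ {x y z a b} → δ {3} d x y ≤ a → δ d y z ≤ b → δ d x z ≤ a + b
    _⟨→⟩_ {x} {y} {z} p q = ℕ.≤-trans (δ-triangle d x y z) (ℕ.+-mono-≤ p q)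

    rev : ∀ {x y a} → δ {3} d x y ≤ a → δ d y x ≤ a
    rev {x} {y} = subst (_≤ _) (δ-sym d x y)

    rotate : ∀ {x y a} → δ d x y ≤ a → δ d (σ d x) (σ d y) ≤ a
    rotate {x} {y} = subst (_≤ _) (sym (δ-σ d x y))

    four : ∀ R → R + (R + (R + R)) ≡ 4 * R
    four = solve-∀

    -- σ changes all d letters, and d exceeds four times the bound R on all radii. This refutes the
    -- patterns whose shifts disagree modulo 3.
    far-from-σ : ∀ {x} → ¬ δ d x (σ d x) ≤ 4 * R
    far-from-σ {x} le = ℕ.<⇒≱ small (subst (_≤ 4 * R) (δ-σʳ d x) le)

  module _ {k} (b : Fin k → Fin k → Bool) (pos : Fin k → Fin K) (pt : Fin k → Fin (3 ^ d))
    (close : ∀ p q → toℕ (pos p) < toℕ (pos q) →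
      b p q ≡ ⌊ δ d (σ d (pt p)) (pt q) ℕ.≤? ρ (toℕ (pos p)) (toℕ (pos q)) ⌋) where

    open Patterns b

    private
      π : Fin k → ℕ
      π = toℕ ∘ pos

      π<K : ∀ p → π p < K
      π<K p = Fin.toℕ<n (pos p)

      near : ∀ {p q} → π p < π q → T (b p q) → δ d (σ d (pt p)) (pt q) ≤ ρ (π p) (π q)
      near {p} {q} p<q t = toWitness (subst T (close p q p<q) t)

      near-R : ∀ {p q} → π p < π q → T (b p q) → δ d (σ d (pt p)) (pt q) ≤ R
      near-R {p} {q} p<q t = ℕ.≤-trans (near p<q t) (radius-≤ K r₀ (π q) (π<K p))

      not-near : ∀ {p q} → π p < π q → T (not (b p q)) → ¬ δ d (σ d (pt p)) (pt q) ≤ ρ (π p) (π q)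
      not-near {p} {q} p<q t le with b p q | trans (close p q p<q) (Equivalence.to T-≡ (fromWitness le))
      ... | true | _ = t

      T-∧³ : ∀ {w x y} → T (w ∧ x ∧ y) → T w × T x × T y
      T-∧³ t = map₂ (Equivalence.to T-∧) (Equivalence.to T-∧ t)

      T-∧⁴ : ∀ {w x y z} → T (w ∧ x ∧ y ∧ z) → T w × T x × T y × T z
      T-∧⁴ t = map₂ T-∧³ (Equivalence.to T-∧ t)

    -- The point of r is near σ of the point of p directly, but near σ² of it by way of q.
    no-pattern₃ : ∀ p q r → π p < π q → π q < π r → ¬ T (pattern₃ p q r)
    no-pattern₃ p q r p<q q<r t =
      let pq , qr , pr = T-∧³ t in
      far-from-σ (ℕ.≤-trans
        (near-R (ℕ.<-trans p<q q<r) pr ⟨→⟩ rev (near-R q<r qr) ⟨→⟩ rev (rotate (near-R p<q pq)))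
        (ℕ.≤-trans (ℕ.m≤n+m _ R) (ℕ.≤-reflexive (four R))))

    no-pattern₄ : ∀ p q r s → π p < π q → π q < π r → π r < π s → ¬ T (pattern₄ p q r s)
    no-pattern₄ p q r s p<q q<r r<s t with Equivalence.to T-∨ t
    -- By way of q and r, the point of s is near σ³ = id of the point of p; directly, it is near σ
    -- of it.
    ... | inj₁ t =
      let pq , qr , rs , ps = T-∧⁴ t in
      far-from-σ (ℕ.≤-trans
        (subst (λ x → δ d x (σ d (σ d (pt q))) ≤ R) (σ³ d (pt p)) (rotate (rotate (near-R p<q pq)))
          ⟨→⟩ rotate (near-R q<r qr) ⟨→⟩ near-R r<s rs
          ⟨→⟩ rev (near-R (ℕ.<-trans p<q (ℕ.<-trans q<r r<s)) ps))
        (ℕ.≤-reflexive (four R)))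
    ... | inj₂ t with Equivalence.to T-∨ t
    -- The path r, p, q, s has total shift -1 + 1 + 1 = 1, so it makes s close to σ r. Its three
    -- radii have first index p or q, before r.
    ... | inj₁ t =
      let pq , pr , qs , ¬rs = T-∧⁴ t
          p<r = ℕ.<-trans p<q q<r in
      not-near r<s ¬rs (ℕ.≤-trans
        (rotate (rev (near p<r pr)) ⟨→⟩ rotate (near p<q pq) ⟨→⟩ near (ℕ.<-trans q<r r<s) qs)
        (three-powers K r₀ (exponent-<ˡ K r₀ (π r) p<r (π<K s)) (exponent-<ˡ K r₀ (π q) p<r (π<K s))
                           (exponent-<ˡ K r₀ (π s) q<r (π<K s))))
    -- The path q, s, p, r has total shift 1 - 1 + 1 = 1. The radius of (q , s) is below that of (q
    -- , r) since s comes after r; the other two have first index p, before q.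
    ... | inj₂ t =
      let pr , ps , qs , ¬qr = T-∧⁴ t
          q<s = ℕ.<-trans q<r r<s in
      not-near q<r ¬qr (ℕ.≤-trans
        (near q<s qs ⟨→⟩ rev (near (ℕ.<-trans p<q q<s) ps) ⟨→⟩ near (ℕ.<-trans p<q q<r) pr)
        (three-powers K r₀ (exponent-<ʳ K r₀ (π q) r<s (ℕ.<⇒≤ (π<K s)))
                           (exponent-<ˡ K r₀ (π s) p<q (π<K r)) (exponent-<ˡ K r₀ (π r) p<q (π<K r))))

  -- The tournament G.

  blk : Fin (K * 3 ^ d) → Fin K
  blk = quotient (3 ^ d)

  pt : Fin (K * 3 ^ d) → Fin (3 ^ d)
  pt = remainder {K} (3 ^ d)

  -- The rule also governs pairs inside one block, so that large pure pairs are excluded there too.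
  back : Fin (K * 3 ^ d) → Fin (K * 3 ^ d) → Bool
  back u v = ⌊ δ d (σ d (pt u)) (pt v) ℕ.≤? ρ (toℕ (blk u)) (toℕ (blk v)) ⌋

  G : Tournament (K * 3 ^ d)
  G = backedgeTournament back

  blk-< : ∀ {u v} → toℕ (blk u) < toℕ (blk v) → u Fin.< v
  blk-< {u} {v} lt = subst₂ Fin._<_ (Fin.combine-remQuot {K} (3 ^ d) u)
    (Fin.combine-remQuot {K} (3 ^ d) v)
    (Fin.combine-monoˡ-< (pt u) (pt v) lt)

  -- The blocks order the vertices of H. The search finds a pattern in this order, and the radii
  -- forbid it.
  no-transversal-copy : ∀ {k} (H : Tournament k) → UnavoidablePattern H →
    (f : Fin k → Fin (K * 3 ^ d)) → (∀ p q → edge H p q ≡ edge G (f p) (f q)) →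
    (∀ {p q} → p ≢ q → blk (f p) ≢ blk (f q)) → ⊥
  no-transversal-copy H unav f edges distinct =
    Patterns.avoidable b (toℕ ∘ blk ∘ f)
      (no-pattern₃ b (blk ∘ f) (pt ∘ f) close) (no-pattern₄ b (blk ∘ f) (pt ∘ f) close)
      [] (allFin _) [] (All.tabulate λ _ → [])
      (AllPairs.map (λ p≢q → distinct p≢q ∘ Fin.toℕ-injective) (Unique.allFin⁺ _)) unav
    where
    b = λ p q → edge H q p
    close : ∀ p q → toℕ (blk (f p)) < toℕ (blk (f q)) → b p q ≡ back (f p) (f q)
    close p q lt = trans (edges q p) (backedge back (blk-< lt))

-- Absence of large pure pairs.

large-block : ∀ {K M} .{{_ : NonZero K}} (A : Subset (K * M)) → M ≤ K * ∣ A ∣ →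
              ∃[ i ] M ≤ K * K * count (λ x → lookup A (combine i x))
large-block {K} {M} A M≤ =
  let i , le = sum≤n*max (λ i → count (λ x → lookup A (combine i x))) in
  i , (begin
    M                ≤⟨ M≤ ⟩
    K * ∣ A ∣        ≡⟨ cong (K *_) (trans (∣∣≡count A) (sum-combine K (𝟙 ∘ lookup A))) ⟩
    K * _            ≤⟨ ℕ.*-monoʳ-≤ K le ⟩
    K * (K * _)      ≡⟨ ℕ.*-assoc K K _ ⟨
    K * K * _        ∎)
  where open ℕ.≤-Reasoning

module Example (K r₀ d : ℕ) .{{K≢0 : NonZero K}} (small : 4 * (r₀ * 3 ^ (K * K)) < d)
               (r₀²≡K⁴d : r₀ * r₀ ≡ K * K * (K * K) * d) where

  open Rainbow K r₀ d small public using (G; blk; pt; back; no-transversal-copy)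

  private
    M = 3 ^ d
    n = K * M

    vertex : Fin K → Fin M → Fin n
    vertex = combine

  instance
    M≢0 : NonZero M
    M≢0 = ℕ.m^n≢0 3 d

  back-vertex : ∀ i j x y → back (vertex i x) (vertex j y) ≡
                ⌊ δ d (σ d x) y ℕ.≤? radius K r₀ (toℕ i) (toℕ j) ⌋
  back-vertex i j x y =
    cong₂ (λ (i , x) (j , y) → ⌊ δ d (σ d x) y ℕ.≤? radius K r₀ (toℕ i) (toℕ j) ⌋)
      (Fin.remQuot-combine i x) (Fin.remQuot-combine j y)

  -- Suppose y is within r₀ of σ x. If u comes first, the pair is backward, as every radius is at
  -- least r₀, against the edge from u to v. If v comes first, that edge is backward, so x is near σ
  -- y and hence near σ² x, although x = σ³ x is at distance d from σ² x.
  pure-far : (P : PurePair G) → let open PurePair P in ∀ i j x y →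
             T (lookup A (vertex i x)) → T (lookup B (vertex j y)) → suc r₀ ≤ δ d (σ d x) y
  pure-far P i j x y x∈ y∈ = ℕ.≰⇒> close⇒⊥
    where
    open PurePair P
    u = vertex i x
    v = vertex j y

    u∈A : u ∈ A
    u∈A = lookup⇒[]= u A (Equivalence.to T-≡ x∈)
    v∈B : v ∈ B
    v∈B = lookup⇒[]= v B (Equivalence.to T-≡ y∈)

    close⇒⊥ : ¬ δ d (σ d x) y ≤ r₀
    close⇒⊥ le with Fin.<-cmp u v
    ... | tri< u<v _ _ = contradiction
      (trans (sym (complete u v u∈A v∈B)) (trans (forward-edge back u<v) (cong not
        (trans (back-vertex i j x y) (Equivalence.to T-≡ (fromWitness (ℕ.≤-trans le (radius-≥ K r₀ (toℕ i) (toℕ j)))))))))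
      λ ()
    ... | tri≈ _ u≡v _ = disjoint u u∈A (subst (_∈ B) (sym u≡v) v∈B)
    ... | tri> _ _ v<u = ℕ.<⇒≱ small (begin
      d                                                     ≡⟨ δ-σʳ d (σ d (σ d x)) ⟨
      δ d (σ d (σ d x)) (σ d (σ d (σ d x)))                 ≡⟨ cong (δ d (σ d (σ d x))) (σ³ d x) ⟩
      δ d (σ d (σ d x)) x                                   ≤⟨ δ-triangle d (σ d (σ d x)) (σ d y) x ⟩
      δ d (σ d (σ d x)) (σ d y) + δ d (σ d y) x             ≡⟨ cong (_+ δ d (σ d y) x) (δ-σ d (σ d x) y) ⟩
      δ d (σ d x) y + δ d (σ d y) x                         ≤⟨ ℕ.+-mono-≤ le′ v-close-u ⟩
      R + R                                                 ≤⟨ ℕ.+-monoʳ-≤ R (ℕ.m≤m+n R _) ⟩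
      4 * R                                                 ∎)
      where
      open ℕ.≤-Reasoning
      R = r₀ * 3 ^ (K * K)
      v-close-u : δ d (σ d y) x ≤ R
      v-close-u = ℕ.≤-trans
        (toWitness (Equivalence.from T-≡ (trans (sym (back-vertex j i y x))
          (trans (sym (backedge back v<u)) (complete u v u∈A v∈B)))))
        (radius-≤ K r₀ (toℕ i) (Fin.toℕ<n j))
      le′ : δ d (σ d x) y ≤ R
      le′ = ℕ.≤-trans le (ℕ.m≤m*n r₀ (3 ^ (K * K)) {{ℕ.m^n≢0 3 (K * K)}})

  -- By pigeonhole, A and B each have at least M / K² points in some block. These have distance
  -- above r₀ after rotation, so `rotated-sets-far` gives (r₀ + 1)² ≤ K⁴ d = r₀².
  no-large-pure-pair : (P : PurePair G) → ¬ M ≤ K * PurePair.order P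
  no-large-pure-pair P M≤ =
    let i , M≤X = large-block {K} {M} A (ℕ.≤-trans M≤ (ℕ.*-monoʳ-≤ K (ℕ.m⊓n≤m ∣ A ∣ ∣ B ∣)))
        j , M≤Y = large-block {K} {M} B (ℕ.≤-trans M≤ (ℕ.*-monoʳ-≤ K (ℕ.m⊓n≤n ∣ A ∣ ∣ B ∣)))
        X = λ x → lookup A (vertex i x)
        Y = λ y → lookup B (vertex j y)
    in ℕ.<⇒≱ (ℕ.*-mono-< (ℕ.n<1+n r₀) (ℕ.n<1+n r₀)) (ℕ.*-cancelˡ-≤ (M * M) {{ℕ.m*n≢0 M M}} (begin
      M * M * (suc r₀ * suc r₀)
        ≤⟨ ℕ.*-monoˡ-≤ (suc r₀ * suc r₀) (ℕ.*-mono-≤ M≤X M≤Y) ⟩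
      K * K * count X * (K * K * count Y) * (suc r₀ * suc r₀)
        ≡⟨ arith₁ (K * K) (count X) (count Y) (suc r₀ * suc r₀) ⟩
      K * K * (K * K) * (count X * count Y * (suc r₀ * suc r₀))
        ≤⟨ ℕ.*-monoʳ-≤ (K * K * (K * K)) (rotated-sets-far d X Y (suc r₀) (pure-far P i j)) ⟩
      K * K * (K * K) * (d * (M * M))
        ≡⟨ arith₂ (K * K * (K * K)) d (M * M) ⟩
      M * M * (K * K * (K * K) * d)
        ≡⟨ cong (M * M *_) r₀²≡K⁴d ⟨
      M * M * (r₀ * r₀) ∎))
    where
    open PurePair P
    open ℕ.≤-Reasoning
    arith₁ : ∀ a x y r → a * x * (a * y) * r ≡ a * a * (x * y * r)
    arith₁ = solve-∀
    arith₂ : ∀ a d m → a * (d * m) ≡ m * (a * d)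
    arith₂ = solve-∀

  -- The blockade.

  index : Fin K → ℤ
  index i = ℤ.+ toℕ i

  index-injective : ∀ {i j} → index i ≡ index j → i ≡ j
  index-injective eq = Fin.toℕ-injective (ℤ.+-injective eq)

  in-block : ℤ → Fin n → Bool
  in-block z v = ⌊ index (blk v) ℤ.≟ z ⌋

  ∈-block⁺ : ∀ {z v} → index (blk v) ≡ z → v ∈ tabulate (in-block z)
  ∈-block⁺ {z} {v} eq = lookup⇒[]= v _ (trans (lookup∘tabulate (in-block z) v)
    (Equivalence.to T-≡ (fromWitness eq)))

  ∈-block⁻ : ∀ {z v} → v ∈ tabulate (in-block z) → index (blk v) ≡ z
  ∈-block⁻ {z} {v} v∈ = toWitness (Equivalence.from T-≡
    (trans (sym (lookup∘tabulate (in-block z) v)) ([]=⇒lookup v∈)))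

  blk-vertex : ∀ i x → blk (vertex i x) ≡ i
  blk-vertex i x = cong proj₁ (Fin.remQuot-combine i x)

  blocks : Blockade n
  blocks = record
    { I        = List.tabulate index
    ; I-unique = Unique.tabulate⁺ {f = index} index-injective
    ; block    = λ z → tabulate (in-block z)
    ; nonempty = λ z z∈ → let i , z≡ = ∈-tabulate⁻ {f = index} z∈ in
        vertex i (Fin.fromℕ< (ℕ.m^n>0 3 d)) ,
        ∈-block⁺ (trans (cong index (blk-vertex i _)) (sym z≡))
    ; disjoint = λ y z _ _ y≢z v v∈y v∈z → y≢z (trans (sym (∈-block⁻ v∈y)) (∈-block⁻ v∈z))
    }

  block-large : ∀ i → M ≤ ∣ Blockade.block blocks (index i) ∣
  block-large i = begin
    M ≡⟨ trans (sum-const M 1) (ℕ.*-identityʳ M) ⟨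
    ∑[ _ < M ] 1 ≡⟨ sum-cong-≗ {M} member ⟨
    ∑[ x < M ] 𝟙 (lookup C (vertex i x))
      ≤⟨ term≤sum (λ j → ∑[ x < M ] 𝟙 (lookup C (vertex j x))) i ⟩
    ∑[ j < K ] ∑[ x < M ] 𝟙 (lookup C (vertex j x)) ≡⟨ sum-combine K (𝟙 ∘ lookup C) ⟨
    count (lookup C) ≡⟨ ∣∣≡count C ⟨
    ∣ C ∣ ∎
    where
    open ℕ.≤-Reasoning
    C = Blockade.block blocks (index i)
    member : ∀ x → 𝟙 (lookup C (vertex i x)) ≡ 1
    member x = cong 𝟙 ([]=⇒lookup (∈-block⁺ (cong index (blk-vertex i x))))

  width≥M : M ≤ width blocks
  -- The first argument handles the default value K * M of the minimum.
  width≥M = v≤min⁺ (ℕ.m≤n*m M K) (All.map⁺ {f = ∣_∣ ∘ Blockade.block blocks}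
    (All.tabulate⁺ {f = index} block-large))

  length≡K : blockadeLength blocks ≡ K
  length≡K = List.length-tabulate index

  no-rainbow-copy : ∀ {h} (H : Tournament h) → UnavoidablePattern H → ¬ RainbowCopy H G blocks
  no-rainbow-copy H unav (X , copy , _ , rainbow) =
    no-transversal-copy H unav f edges λ {p} {q} p≢q same →
      rainbow (f p) (f q) (index (blk (f p))) (f∈X p) (f∈X q) (p≢q ∘ injective)
        (∈-tabulate⁺ {f = index} (blk (f p))) (∈-block⁺ refl , ∈-block⁺ (cong index (sym same)))
    where
    open IsCopy copy
    f∈X : ∀ p → f p ∈ X
    f∈X p = Equivalence.from (image (f p)) (p , refl)

-- Rational and real bounds.

toℚᵘ-*-fromℕ : ∀ q n → toℚᵘ (q ℚ.* fromℕ n) ℚᵘ.≃ toℚᵘ q ℚᵘ.* mkℚᵘ (ℤ.+ n) 0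
toℚᵘ-*-fromℕ q n = ℚᵘ.≃-trans (ℚ.toℚᵘ-homo-* q (fromℕ n))
  (ℚᵘ.*-congˡ {toℚᵘ q} (ℚ.toℚᵘ-fromℚᵘ (mkℚᵘ (ℤ.+ n) 0)))

-- K is the denominator of q. The numerator is at least 1, which gives both bounds once the
-- denominator is cleared.
reciprocal-bound : ∀ q → 0ℚ ℚ.< q → ∃[ K ] NonZero K × 1ℚ ℚ.≤ q ℚ.* fromℕ K ×
                   (∀ m n → q ℚ.* fromℕ m ℚ.≤ fromℕ n → m ≤ K * n)
reciprocal-bound (mkℚ (ℤ.+ 0)      _ _) (ℚ.*<* (ℤ.+<+ ()))
reciprocal-bound (mkℚ ℤ.-[1+ _ ]   _ _) (ℚ.*<* ())
reciprocal-bound q@(mkℚ (ℤ.+ suc a) k _) _ = suc k , _ , lower , upper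
  where
  lower : 1ℚ ℚ.≤ q ℚ.* fromℕ (suc k)
  lower = ℚ.toℚᵘ-cancel-≤ (ℚᵘ.≤-respʳ-≃ (ℚᵘ.≃-sym (toℚᵘ-*-fromℕ q (suc k)))
    (ℚᵘ.*≤* (ℤ.+≤+ (s≤s (begin
      k * 1 + 0           ≡⟨ arith k ⟩
      k                   ≤⟨ ℕ.m≤m+n k (a * suc k) ⟩
      k + a * suc k       ≡⟨ ℕ.*-identityʳ _ ⟨
      (k + a * suc k) * 1 ∎)))))
    where
    open ℕ.≤-Reasoning
    arith : ∀ k → k * 1 + 0 ≡ k
    arith = solve-∀

  upper : ∀ m n → q ℚ.* fromℕ m ℚ.≤ fromℕ n → m ≤ suc k * n
  upper m n le with ℚᵘ.≤-respˡ-≃ (toℚᵘ-*-fromℕ q m)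
    (ℚᵘ.≤-respʳ-≃ (ℚ.toℚᵘ-fromℚᵘ (mkℚᵘ (ℤ.+ n) 0)) (ℚ.toℚᵘ-mono-≤ le))
  ... | ℚᵘ.*≤* le′ = ℕ.≤-trans (ℕ.m≤m+n m (a * m)) (ℤ.drop‿+≤+ (subst₂ ℤ._≤_
    (trans (ℤ.*-identityʳ (ℤ.+ suc a ℤ.* ℤ.+ m)) (sym (ℤ.pos-* (suc a) m)))
    (trans (cong (λ k → ℤ.+ n ℤ.* ℤ.+ suc k) (ℕ.*-identityʳ k))
      (trans (sym (ℤ.pos-* n (suc k))) (cong ℤ.+_ (ℕ.*-comm n (suc k)))))
    le′))

lower<upper : ∀ c {q r} → ℝ.lower c q → ℝ.upper c r → q ℚ.< r
lower<upper c {q} {r} q<c c<r with ℚ.<-cmp q r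
... | tri< q<r _ _  = q<r
... | tri≈ _ refl _ = contradiction (q<c , c<r) (ℝ.disjoint c q)
... | tri> _ _ r<q  = contradiction (Equivalence.from (ℝ.lower-rounded c r) (q , r<q , q<c) , c<r)
                                    (ℝ.disjoint c r)

-- Choice of parameters.

n<3^n : ∀ n → n < 3 ^ n
n<3^n zero    = s≤s z≤n
n<3^n (suc n) = begin-strict
  suc n           ≤⟨ n<3^n n ⟩
  3 ^ n           <⟨ ℕ.m<m*n (3 ^ n) 3 {{ℕ.m^n≢0 3 n}} (s≤s (s≤s z≤n)) ⟩
  3 ^ n * 3       ≡⟨ ℕ.*-comm (3 ^ n) 3 ⟩
  3 * 3 ^ n       ∎
  where open ℕ.≤-Reasoning

-- Taking d = s² makes r₀ = K² √d an integer. The first inequality then amounts to s > 4 K² 3 ^ (K *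
-- K), and the summand N in s makes 3 ^ d large.
parameters : ∀ K N → ∃[ d ] ∃[ r₀ ]
  4 * (r₀ * 3 ^ (K * K)) < d × r₀ * r₀ ≡ K * K * (K * K) * d × N ≤ 3 ^ d
parameters K N = s * s , s * (K * K) , small , square s (K * K) , N≤3^d
  where
  open ℕ.≤-Reasoning
  p = 3 ^ (K * K)
  s = suc (4 * (K * K * p)) + N

  arith : ∀ s a b → 4 * (s * a * b) ≡ s * (4 * (a * b))
  arith = solve-∀

  square : ∀ s a → s * a * (s * a) ≡ a * a * (s * s)
  square = solve-∀

  small : 4 * (s * (K * K) * p) < s * s
  small = begin-strict
    4 * (s * (K * K) * p) ≡⟨ arith s (K * K) p ⟩
    s * (4 * (K * K * p)) <⟨ ℕ.*-monoʳ-< s (ℕ.m≤m+n _ N) ⟩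
    s * s                 ∎

  N≤3^d : N ≤ 3 ^ (s * s)
  N≤3^d = begin
    N           ≤⟨ ℕ.m≤n+m N _ ⟩
    s           ≤⟨ ℕ.m≤m*n s s ⟩
    s * s       ≤⟨ ℕ.<⇒≤ (n<3^n (s * s)) ⟩
    3 ^ (s * s) ∎

-- The counterexample and its consequences.

module Counterexample (c : ℝ) (N : ℕ) where

  -- The last clause quantifies over H so that a single G serves both tournaments.
  Counterexample : Set
  Counterexample = ∃[ n ] n ≥ N × (Σ (Tournament n) λ G → Σ (Blockade n) λ 𝓑 →
      blockadeLength 𝓑 ≥1/ c
    × ¬ PurePairOfOrderAtLeast c G 𝓑
    × (∀ {h} (H : Tournament h) → UnavoidablePattern H → ¬ RainbowCopy H G 𝓑))

  from-parameters : ∀ {q K d r₀} → ℝ.lower c q → NonZero K →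
    1ℚ ℚ.≤ q ℚ.* fromℕ K → (∀ m n → q ℚ.* fromℕ m ℚ.≤ fromℕ n → m ≤ K * n) →
    4 * (r₀ * 3 ^ (K * K)) < d → r₀ * r₀ ≡ K * K * (K * K) * d → N ≤ 3 ^ d → Counterexample
  from-parameters {q} {K} {d} {r₀} q<c K≢0 1≤qK ≤K* small r₀²≡K⁴d N≤3^d =
    K * 3 ^ d , ℕ.≤-trans N≤3^d (ℕ.m≤n*m (3 ^ d) K {{K≢0}}) ,
    G , blocks , long , no-pure-pair , no-rainbow-copy
    where
    open Example K r₀ d {{K≢0}} small r₀²≡K⁴d

    long : blockadeLength blocks ≥1/ c
    long r c<r = subst (λ l → 1ℚ ℚ.≤ r ℚ.* fromℕ l) (sym length≡K)
      (ℚ.≤-trans 1≤qK (ℚ.*-monoʳ-≤-nonNeg (fromℕ K) {{ℚ.normalize-nonNeg K 1}}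
        (ℚ.<⇒≤ (lower<upper c q<c c<r))))

    no-pure-pair : ¬ PurePairOfOrderAtLeast c G blocks
    -- Evaluated at q < c, the order of P is at least q times the width, so K times the order is at
    -- least the width, hence at least 3 ^ d.
    no-pure-pair (P , large) = no-large-pure-pair P
      (ℕ.≤-trans width≥M (≤K* (width blocks) (PurePair.order P) (large q q<c)))

  counterexample : Positive c → Counterexample
  counterexample 0<c =
    -- Roundedness of the cut gives a positive rational below c, which replaces c from here on.
    let q , 0<q , q<c = Equivalence.to (ℝ.lower-rounded c 0ℚ) 0<c
        K , K≢0 , 1≤qK , ≤K* = reciprocal-bound q 0<q
        d , r₀ , small , r₀²≡K⁴d , N≤3^d = parameters K N
    in from-parameters {r₀ = r₀} q<c K≢0 1≤qK ≤K* small r₀²≡K⁴d N≤3^d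

open Counterexample using (counterexample)

¬RSEH : ∀ {h} (H : Tournament h) → UnavoidablePattern H → ¬ RSEH H
¬RSEH H unav (c , 0<c , _ , rseh) =
  let n , _ , G , 𝓑 , long , no-pure-pair , no-copy = counterexample c 0 0<c in
  no-pure-pair (rseh n G 𝓑 long (no-copy H unav))

mainTheorem5 : ((c : ℝ) → Positive c →
    ∀ (N : ℕ) → ∃[ n ] n ≥ N ×
    (Σ (Tournament n) λ G → Σ (Blockade n) λ 𝓑 →
    blockadeLength 𝓑 ≥1/ c
    × ¬ PurePairOfOrderAtLeast c G 𝓑
    × ¬ RainbowCopy D₅ G 𝓑
    × ¬ RainbowCopy P₇⁻ G 𝓑))
    × ¬ RSEH D₅
    × ¬ RSEH P₇⁻
mainTheorem5 =
  (λ c 0<c N → let n , n≥N , G , 𝓑 , long , no-pure-pair , no-copy = counterexample c N 0<c in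
    n , n≥N , G , 𝓑 , long , no-pure-pair , no-copy D₅ D₅-unavoidable , no-copy P₇⁻ P₇⁻-unavoidable) ,
  ¬RSEH D₅ D₅-unavoidable ,
  ¬RSEH P₇⁻ P₇⁻-unavoidable
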